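{- Let $r\geq 3$, $s\geq 3$ and $\ell>4$ be fixed integers. Then there is a constant $C(r,s,\ell)$ such that every connected $(K_{1,r},K_s^h,P_\ell)$-free graph $G$ (of order at least $3$) satisfies $rx_3(G)\leq sdiam_3(G)+C(r,s,\ell)$.
   Context: All graphs are finite, simple, undirected. A tree in an edge-colored graph is rainbow if no two of its edges have the same color; an $S$-tree is a tree containing all vertices of $S$. A $3$-rainbow coloring of a connected graph $G$ is an edge-coloring (adjacent edges may share colors) such that every $3$-element vertex set $S$ has a rainbow $S$-tree; $rx_3(G)$ is the minimum number of colors in such a coloring. $sdiam_3(G)$ is the maximum, over all $3$-element $S\subseteq V(G)$, of the minimum number of edges of an $S$-tree. $(K_{1,r},K_s^h,P_\ell)$-free means no induced subgraph isomorphic to any of these. $P_n$ is the path on $n$ vertices, $K_{1,r}$ the star with $r$ leaves, $K_s^h$ the graph obtained from $K_s$ by attaching a pendant edge to each vertex. -}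

module Defs where

open import Level using (0ℓ)
open import Data.Nat as ℕ using (ℕ; suc; _+_; _≤_)
open import Data.Fin as Fin using (Fin; zero; suc; toℕ; fromℕ; inject₁)
open import Data.Fin.Subset using (Subset; _∈_; _⊆_; Nonempty; ∣_∣)
open import Data.List using (length; filter; allFin; cartesianProduct)
open import Data.Product using (Σ-syntax; _×_; _,_)
open import Data.Sum using (_⊎_; inj₁; inj₂; swap)
open import Data.Unit using (⊤; tt)
open import Data.Empty using (⊥)
open import Function.Bundles using (_⇔_)
open import Function.Definitions using (Injective)
open import Relation.Binary.Core using (Rel)
open import Relation.Binary.Definitions using (Symmetric; Irreflexive; Decidable)
open import Relation.Binary.Construct.Closure.ReflexiveTransitive using (Star)
open import Relation.Binary.PropositionalEquality using (_≡_; _≢_; refl; sym; ≢-sym)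
open import Relation.Nullary using (¬_; Dec; yes; no)
open import Relation.Nullary.Decidable using (_×-dec_; _⊎-dec_; ¬?)
open import Relation.Unary using (Pred)
import Data.Nat.Properties as ℕₚ

IsMinimum : ∀ {a} → Pred ℕ a → Pred ℕ a
IsMinimum P m = P m × (∀ j → P j → m ≤ j)

IsMaximum : ∀ {a} → Pred ℕ a → Pred ℕ a
IsMaximum P m = P m × (∀ j → P j → j ≤ m)

-- Simple undirected graphs; finiteness is imposed by taking V = Fin n.
record Graph (V : Set) : Set₁ where
  field
    Adj        : Rel V 0ℓ
    adj-sym    : Symmetric Adj
    adj-irrefl : Irreflexive _≡_ Adj
    adj?       : Decidable Adj

open Graph public

Connected : ∀ {V} → Graph V → Set
Connected G = ∀ u v → Star (Adj G) u v

InducedCopy : ∀ {W V} → Graph W → Graph V → Set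
InducedCopy {W} {V} H G =
  Σ[ f ∈ (W → V) ] Injective _≡_ _≡_ f × (∀ x y → Adj H x y ⇔ Adj G (f x) (f y))

_-Free_ : ∀ {W V} → Graph W → Graph V → Set
H -Free G = ¬ InducedCopy H G

path : (ℓ : ℕ) → Graph (Fin ℓ)
path ℓ = record
  { Adj        = λ i j → suc (toℕ i) ≡ toℕ j ⊎ suc (toℕ j) ≡ toℕ i
  ; adj-sym    = swap
  ; adj-irrefl = λ { refl (inj₁ p) → ℕₚ.1+n≢n p ; refl (inj₂ p) → ℕₚ.1+n≢n p }
  ; adj?       = λ i j → (suc (toℕ i) ℕ.≟ toℕ j) ⊎-dec (suc (toℕ j) ℕ.≟ toℕ i)
  }

StarAdj : ∀ r → Rel (⊤ ⊎ Fin r) 0ℓ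
StarAdj r (inj₁ _) (inj₁ _) = ⊥
StarAdj r (inj₁ _) (inj₂ _) = ⊤
StarAdj r (inj₂ _) (inj₁ _) = ⊤
StarAdj r (inj₂ _) (inj₂ _) = ⊥

-- K_{1,r}: inj₁ tt is the centre, inj₂ i are the leaves.
star : (r : ℕ) → Graph (⊤ ⊎ Fin r)
star r = record
  { Adj        = StarAdj r
  ; adj-sym    = λ {x} {y} → symm x y
  ; adj-irrefl = λ { {inj₁ _} refl () ; {inj₂ _} refl () }
  ; adj?       = dec
  }
  where
  symm : ∀ x y → StarAdj r x y → StarAdj r y x
  symm (inj₁ _) (inj₂ _) _ = tt
  symm (inj₂ _) (inj₁ _) _ = tt

  dec : Decidable (StarAdj r)
  dec (inj₁ _) (inj₁ _) = no λ ()
  dec (inj₁ _) (inj₂ _) = yes tt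
  dec (inj₂ _) (inj₁ _) = yes tt
  dec (inj₂ _) (inj₂ _) = no λ ()

PendantAdj : ∀ s → Rel (Fin s ⊎ Fin s) 0ℓ
PendantAdj s (inj₁ i) (inj₁ j) = i ≢ j
PendantAdj s (inj₁ i) (inj₂ j) = i ≡ j
PendantAdj s (inj₂ i) (inj₁ j) = i ≡ j
PendantAdj s (inj₂ _) (inj₂ _) = ⊥

-- K_s^h: inj₁ i are the vertices of K_s, inj₂ i is the pendant vertex at inj₁ i.
pendantClique : (s : ℕ) → Graph (Fin s ⊎ Fin s)
pendantClique s = record
  { Adj        = PendantAdj s
  ; adj-sym    = λ {x} {y} → symm x y
  ; adj-irrefl = λ { {inj₁ _} refl p → p refl ; {inj₂ _} refl () }
  ; adj?       = dec
  }
  where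
  symm : ∀ x y → PendantAdj s x y → PendantAdj s y x
  symm (inj₁ _) (inj₁ _) p = ≢-sym p
  symm (inj₁ _) (inj₂ _) p = sym p
  symm (inj₂ _) (inj₁ _) p = sym p

  dec : Decidable (PendantAdj s)
  dec (inj₁ i) (inj₁ j) = ¬? (i Fin.≟ j)
  dec (inj₁ i) (inj₂ j) = i Fin.≟ j
  dec (inj₂ i) (inj₁ j) = i Fin.≟ j
  dec (inj₂ _) (inj₂ _) = no λ ()

-- A cycle of length 3 + k: distinct vertices, consecutive ones adjacent, and
-- the last adjacent to the first.
record Cycle {V : Set} (G : Graph V) : Set where
  field
    k        : ℕ
    vertex   : Fin (3 + k) → V
    distinct : Injective _≡_ _≡_ vertex
    step     : ∀ (i : Fin (2 + k)) → Adj G (vertex (inject₁ i)) (vertex (suc i))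
    close    : Adj G (vertex (fromℕ (2 + k))) (vertex zero)

-- The edge set is kept as a graph on all of Fin n whose edges have their ends
-- in `vertices`; elements of Fin n outside `vertices` are not part of the subgraph.
record Subgraph {n : ℕ} (G : Graph (Fin n)) : Set₁ where
  field
    vertices : Subset n
    edges    : Graph (Fin n)
    edge⇒adj : ∀ {u v} → Adj edges u v → Adj G u v
    edge⇒∈   : ∀ {u v} → Adj edges u v → u ∈ vertices × v ∈ vertices

open Subgraph public

size : ∀ {n} {G : Graph (Fin n)} → Subgraph G → ℕ
size {n} H = length (filter edge? (cartesianProduct (allFin n) (allFin n)))
  where
  edge? : ((u , v) : Fin n × Fin n) → Dec (u Fin.< v × Adj (edges H) u v)
  edge? (u , v) = (u Fin.<? v) ×-dec adj? (edges H) u v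

record IsTree {n} {G : Graph (Fin n)} (T : Subgraph G) : Set where
  field
    nonempty  : Nonempty (vertices T)
    connected : ∀ {u v} → u ∈ vertices T → v ∈ vertices T → Star (Adj (edges T)) u v
    acyclic   : ¬ Cycle (edges T)

record IsSTree {n} {G : Graph (Fin n)} (S : Subset n) (T : Subgraph G) : Set where
  field
    isTree   : IsTree T
    contains : S ⊆ vertices T

-- `colour-sym` makes the colour depend only on the unordered pair {u , v}.
record EdgeColouring {n} (G : Graph (Fin n)) (k : ℕ) : Set where
  field
    colour     : ∀ {u v} → Adj G u v → Fin k
    colour-sym : ∀ {u v} (e : Adj G u v) (e′ : Adj G v u) → colour e ≡ colour e′

open EdgeColouring public

IsRainbow : ∀ {n k} {G : Graph (Fin n)} → EdgeColouring G k → Subgraph G → Set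
IsRainbow c T =
  ∀ {u v x y} (e : Adj (edges T) u v) (f : Adj (edges T) x y) →
  colour c (edge⇒adj T e) ≡ colour c (edge⇒adj T f) →
  (u ≡ x × v ≡ y) ⊎ (u ≡ y × v ≡ x)

Is3RainbowColouring : ∀ {n k} {G : Graph (Fin n)} → EdgeColouring G k → Set₁
Is3RainbowColouring {n} {_} {G} c =
  ∀ (S : Subset n) → ∣ S ∣ ≡ 3 → Σ[ T ∈ Subgraph G ] IsSTree S T × IsRainbow c T

-- IsRx₃ G k : rx₃(G) = k.
IsRx₃ : ∀ {n} → Graph (Fin n) → ℕ → Set₁
IsRx₃ G = IsMinimum λ k → Σ[ c ∈ EdgeColouring G k ] Is3RainbowColouring c

IsSteinerDistance : ∀ {n} → Graph (Fin n) → Subset n → ℕ → Set₁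
IsSteinerDistance G S = IsMinimum λ m → Σ[ T ∈ Subgraph G ] IsSTree S T × size T ≡ m

-- IsSdiam₃ G d : sdiam₃(G) = d.
IsSdiam₃ : ∀ {n} → Graph (Fin n) → ℕ → Set₁
IsSdiam₃ {n} G = IsMaximum λ m → Σ[ S ∈ Subset n ] ∣ S ∣ ≡ 3 × IsSteinerDistance G S m

{-# OPTIONS --safe #-}

-- P_ℓ-freeness bounds the diameter, so it suffices to bound rx₃(G) absolutely.
--
-- The independence number is bounded layer by layer (distance from a root). A large
-- independent set J in layer k + 1 yields, by three applications of Ramsey's theorem,
-- a large subset on which each chosen parent in layer k is adjacent to no other vertex
-- of J (otherwise there is a K_{1,r}), and whose parents form either a clique, giving
-- K_s^h, or an independent set in layer k.
--
-- Let I₁, I₂, I₃ be successive maximal independent sets, each taken outside the previous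
-- ones, and let D be the vertex set of a tree containing them; |D| is bounded. Number the
-- vertices of D injectively from 1, all others by 0, and colour an edge by the unordered
-- pair of numbers of its ends. Any three vertices outside D have neighbours in I₁, I₂, I₃
-- respectively, and joining them to the tree on D along these edges keeps it rainbow.
module Submission where

open import Defs
open import Data.Nat as ℕ using (ℕ; zero; suc; _+_; _*_; _∸_; _≤_; _<_; z≤n; s≤s)
import Data.Nat.Properties as ℕₚ
open import Data.Fin as Fin using (Fin; zero; suc; toℕ; fromℕ; fromℕ<; inject₁; combine)
import Data.Fin.Properties as Finₚ
open import Data.Fin.Subset as Subset using (Subset; ∣_∣)
import Data.Fin.Subset.Properties as Subsetₚ
open import Data.Fin.Relation.Unary.Top using (view; ‵fromℕ; ‵inj₁)
open import Data.List using (List; []; _∷_; _++_; length; map; lookup; allFin)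
import Data.List.Properties as Listₚ
open import Data.List.Membership.Propositional using (_∈_; _∉_; find)
import Data.List.Membership.DecPropositional as DecMembership
open import Data.List.Relation.Binary.Subset.Propositional using () renaming (_⊆_ to _⊆ᵐ_)
open import Data.List.Membership.Propositional.Properties
  using (∈-allFin; ∈-map⁺; ∈-++⁺ˡ; ∈-++⁺ʳ; ∈-lookup)
open import Data.List.Relation.Unary.Any as Any using (here; there)
open import Data.List.Relation.Unary.All as All using (All; []; _∷_)
import Data.List.Relation.Unary.All.Properties as Allₚ
open import Data.List.Relation.Unary.AllPairs as AllPairs using (AllPairs; []; _∷_)
import Data.List.Relation.Unary.AllPairs.Properties as AllPairsₚ
open import Data.List.Relation.Binary.Sublist.Propositional using (_⊆_; []; _∷_; _∷ʳ_; ⊆-refl; ⊆-trans; minimum)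
open import Data.List.Relation.Binary.Sublist.Propositional.Properties using (All-resp-⊆)
open import Data.Product as Product using (Σ-syntax; ∃; ∃-syntax; _×_; _,_; proj₁; proj₂)
open import Data.Sum as Sum using (_⊎_; inj₁; inj₂)
open import Data.Unit using (tt)
open import Data.Empty using (⊥; ⊥-elim)
open import Data.Vec using ([]; _∷_; here; there)
open import Function using (id; _∘_; mk⇔)
open import Relation.Binary.Core using (Rel)
open import Relation.Binary.Definitions using (Symmetric; Decidable; tri<; tri≈; tri>)
open import Relation.Binary.Construct.Closure.ReflexiveTransitive using (Star; ε; _◅_; _◅◅_)
import Relation.Binary.Construct.Closure.ReflexiveTransitive as Star
open import Relation.Binary.PropositionalEquality
open import Relation.Nullary using (¬_; yes; no; contradiction)
open import Relation.Nullary.Decidable using (_×-dec_; _⊎-dec_; ¬?)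
import Relation.Unary as U
open import Level using (Level; 0ℓ)

-- Sublists and Ramsey's theorem.

module _ {n : ℕ} where
  open DecMembership (Fin._≟_ {n}) public using (_∈?_)

module _ {a : Level} {A : Set a} where

  AllPairs-resp-⊆ : ∀ {ℓ} {R : Rel A ℓ} {xs ys} → ys ⊆ xs → AllPairs R xs → AllPairs R ys
  AllPairs-resp-⊆ []         []         = []
  AllPairs-resp-⊆ (_ ∷ʳ τ)   (_  ∷ rs)  = AllPairs-resp-⊆ τ rs
  AllPairs-resp-⊆ (refl ∷ τ) (rx ∷ rs)  = All-resp-⊆ τ rx ∷ AllPairs-resp-⊆ τ rs

  AllPairs-lookup : ∀ {ℓ} {R : Rel A ℓ} → Symmetric R → ∀ {xs} → AllPairs R xs →
                    ∀ i j → i ≢ j → R (lookup xs i) (lookup xs j)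
  AllPairs-lookup s (rx ∷ rs) zero    zero    i≢j = contradiction refl i≢j
  AllPairs-lookup s (rx ∷ rs) zero    (suc j) i≢j = All.lookup rx (∈-lookup j)
  AllPairs-lookup s (rx ∷ rs) (suc i) zero    i≢j = s (All.lookup rx (∈-lookup i))
  AllPairs-lookup s (rx ∷ rs) (suc i) (suc j) i≢j = AllPairs-lookup s rs i j (i≢j ∘ cong suc)

  Sublist : ℕ → (List A → Set a) → List A → Set a
  Sublist k P xs = ∃[ ys ] ys ⊆ xs × length ys ≡ k × P ys

  Sublist-cons : ∀ {k P Q x xs} → (∀ {ys} → ys ⊆ xs → P ys → Q (x ∷ ys)) →
                 Sublist k P xs → Sublist (suc k) Q (x ∷ xs)
  Sublist-cons f (ys , τ , l , p) = _ ∷ ys , refl ∷ τ , cong suc l , f τ p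

  Sublist-mono : ∀ {k P xs zs} → xs ⊆ zs → Sublist k P xs → Sublist k P zs
  Sublist-mono σ (ys , τ , l , p) = ys , ⊆-trans τ σ , l , p

-- An upper bound in the style of Erdős and Szekeres: the `suc` pays for the head of the list, and
-- the sum lets `pigeonhole` split the tail by its relation to that head.
ramseyNumber : ℕ → ℕ → ℕ
ramseyNumber zero    b       = 0
ramseyNumber (suc a) zero    = 0
ramseyNumber (suc a) (suc b) = suc (ramseyNumber a (suc b) + ramseyNumber (suc a) b)

module _ {A : Set} where

  pigeonhole : {P : A → Set} → U.Decidable P → ∀ a b xs → a + b ≤ length xs →
               Sublist a (All P) xs ⊎ Sublist b (All (¬_ ∘ P)) xs
  pigeonhole P? zero    b       xs       h = inj₁ ([] , minimum xs , refl , [])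
  pigeonhole P? (suc a) zero    xs       h = inj₂ ([] , minimum xs , refl , [])
  pigeonhole P? (suc a) (suc b) (x ∷ xs) (s≤s h) with P? x
  ... | yes px with pigeonhole P? a (suc b) xs h
  ...   | inj₁ s = inj₁ (Sublist-cons (λ _ → px ∷_) s)
  ...   | inj₂ s = inj₂ (Sublist-mono (_ ∷ʳ ⊆-refl) s)
  pigeonhole P? (suc a) (suc b) (x ∷ xs) (s≤s h) | no ¬px
    with pigeonhole P? (suc a) b xs (subst (_≤ length xs) (ℕₚ.+-suc a b) h)
  ... | inj₁ s = inj₁ (Sublist-mono (_ ∷ʳ ⊆-refl) s)
  ... | inj₂ s = inj₂ (Sublist-cons (λ _ → ¬px ∷_) s)

  -- R need not be symmetric: AllPairs relates earlier elements to later ones.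
  ramsey : {R : Rel A 0ℓ} → Decidable R → ∀ a b xs → ramseyNumber a b ≤ length xs →
           Sublist a (AllPairs R) xs ⊎ Sublist b (AllPairs (λ x y → ¬ R x y)) xs
  ramsey R? zero    b       xs       h = inj₁ ([] , minimum xs , refl , [])
  ramsey R? (suc a) zero    xs       h = inj₂ ([] , minimum xs , refl , [])
  ramsey R? (suc a) (suc b) (x ∷ xs) (s≤s h)
    with pigeonhole (R? x) (ramseyNumber a (suc b)) (ramseyNumber (suc a) b) xs h
  ... | inj₁ (ys , τ , l , rx) with ramsey R? a (suc b) ys (ℕₚ.≤-reflexive (sym l))
  ...   | inj₁ s = inj₁ (Sublist-mono (refl ∷ τ) (Sublist-cons (λ σ rs → All-resp-⊆ σ rx ∷ rs) s))
  ...   | inj₂ s = inj₂ (Sublist-mono (_ ∷ʳ τ) s)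
  ramsey R? (suc a) (suc b) (x ∷ xs) (s≤s h) | inj₂ (ys , τ , l , rx)
    with ramsey R? (suc a) b ys (ℕₚ.≤-reflexive (sym l))
  ... | inj₁ s = inj₁ (Sublist-mono (_ ∷ʳ τ) s)
  ... | inj₂ s = inj₂ (Sublist-mono (refl ∷ τ) (Sublist-cons (λ σ rs → All-resp-⊆ σ rx ∷ rs) s))

-- Least witnesses, vertex numbers and codes of unordered pairs.

least : {P : ℕ → Set} → U.Decidable P → ∀ k → P k → ∃ (IsMinimum P)
least P? k pk with P? 0
... | yes p₀ = 0 , p₀ , λ _ _ → z≤n
least P? zero    pk | no ¬p₀ = contradiction pk ¬p₀
least P? (suc k) pk | no ¬p₀ with least (P? ∘ suc) k pk
... | m , pm , min = suc m , pm , λ { zero p → contradiction p ¬p₀ ; (suc j) p → s≤s (min j p) }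

-- The length of the suffix that begins at the first occurrence of `v`. Members thus get positive
-- numbers, `0` is left for non-members, and repeated entries do no harm.
rank : ∀ {n} → List (Fin n) → Fin n → ℕ
rank []       v = 0
rank (x ∷ xs) v with v Fin.≟ x
... | yes _ = suc (length xs)
... | no  _ = rank xs v

rank-≤ : ∀ {n} xs (v : Fin n) → rank xs v ≤ length xs
rank-≤ []       v = z≤n
rank-≤ (x ∷ xs) v with v Fin.≟ x
... | yes _ = ℕₚ.≤-refl
... | no  _ = ℕₚ.m≤n⇒m≤1+n (rank-≤ xs v)

rank-∉ : ∀ {n} xs {v : Fin n} → v ∉ xs → rank xs v ≡ 0
rank-∉ []       _ = refl
rank-∉ (x ∷ xs) {v} v∉ with v Fin.≟ x
... | yes v≡x = contradiction (here v≡x) v∉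
... | no  _   = rank-∉ xs (v∉ ∘ there)

rank-∈ : ∀ {n xs} {v : Fin n} → v ∈ xs → rank xs v ≢ 0
rank-∈ {xs = x ∷ xs} {v} v∈ eq with v Fin.≟ x
rank-∈ (here v≡x) eq | no v≢x = v≢x v≡x
rank-∈ (there v∈) eq | no _   = rank-∈ v∈ eq

rank-injective : ∀ {n} xs {u v : Fin n} → u ∈ xs → v ∈ xs → rank xs u ≡ rank xs v → u ≡ v
rank-injective (x ∷ xs) {u} {v} u∈ v∈ eq with u Fin.≟ x | v Fin.≟ x
... | yes u≡x | yes v≡x = trans u≡x (sym v≡x)
... | yes _   | no _    = contradiction (rank-≤ xs v) (ℕₚ.<⇒≱ (ℕₚ.≤-reflexive eq))
... | no _    | yes _   = contradiction (rank-≤ xs u) (ℕₚ.<⇒≱ (ℕₚ.≤-reflexive (sym eq)))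
... | no u≢x  | no v≢x  = rank-injective xs (Any.tail u≢x u∈) (Any.tail v≢x v∈) eq

-- Sorting before `combine` makes the code symmetric, as the colour of an undirected edge must be.
pairCode : ∀ {N} → Fin N → Fin N → Fin (N * N)
pairCode i j with i Fin.≤? j
... | yes _ = combine i j
... | no  _ = combine j i

pairCode-comm : ∀ {N} (i j : Fin N) → pairCode i j ≡ pairCode j i
pairCode-comm i j with i Fin.≤? j | j Fin.≤? i
... | yes i≤j | yes j≤i with refl ← Finₚ.≤-antisym i≤j j≤i = refl
... | yes _   | no _    = refl
... | no _    | yes _   = refl
... | no i≰j  | no j≰i  = contradiction (ℕₚ.<⇒≤ (ℕₚ.≰⇒> i≰j)) j≰i

pairCode-injective : ∀ {N} (i j k l : Fin N) → pairCode i j ≡ pairCode k l →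
                     (i ≡ k × j ≡ l) ⊎ (i ≡ l × j ≡ k)
pairCode-injective i j k l eq with i Fin.≤? j | k Fin.≤? l
... | yes _ | yes _ = inj₁ (Finₚ.combine-injective i j k l eq)
... | yes _ | no _  = inj₂ (Finₚ.combine-injective i j l k eq)
... | no _  | yes _ = inj₂ (Product.swap (Finₚ.combine-injective j i k l eq))
... | no _  | no _  = inj₁ (Product.swap (Finₚ.combine-injective j i l k eq))

-- Subsets as lists, and cycles.

fromList : ∀ {n} → List (Fin n) → Subset n
fromList []       = Subset.⊥
fromList (v ∷ vs) = Subset.⁅ v ⁆ Subset.∪ fromList vs

∈-fromList⁺ : ∀ {n vs} {v : Fin n} → v ∈ vs → v Subset.∈ fromList vs
∈-fromList⁺ (here refl) = Subsetₚ.x∈p∪q⁺ (inj₁ (Subsetₚ.x∈⁅x⁆ _))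
∈-fromList⁺ (there v∈)  = Subsetₚ.x∈p∪q⁺ (inj₂ (∈-fromList⁺ v∈))

∈-fromList⁻ : ∀ {n} vs {v : Fin n} → v Subset.∈ fromList vs → v ∈ vs
∈-fromList⁻ []       v∈ = contradiction v∈ Subsetₚ.∉⊥
∈-fromList⁻ (x ∷ vs) v∈ with Subsetₚ.x∈p∪q⁻ Subset.⁅ x ⁆ (fromList vs) v∈
... | inj₁ v∈x  = here (Subsetₚ.x∈⁅y⁆⇒x≡y x v∈x)
... | inj₂ v∈vs = there (∈-fromList⁻ vs v∈vs)

elements : ∀ {n} → Subset n → List (Fin n)
elements []                   = []
elements (Subset.inside  ∷ p) = zero ∷ map suc (elements p)
elements (Subset.outside ∷ p) = map suc (elements p)

length-elements : ∀ {n} (p : Subset n) → length (elements p) ≡ ∣ p ∣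
length-elements []                   = refl
length-elements (Subset.inside  ∷ p) = cong suc (trans (Listₚ.length-map suc (elements p)) (length-elements p))
length-elements (Subset.outside ∷ p) = trans (Listₚ.length-map suc (elements p)) (length-elements p)

∈-elements : ∀ {n} {p : Subset n} {x} → x Subset.∈ p → x ∈ elements p
∈-elements                          here       = here refl
∈-elements {p = Subset.inside  ∷ p} (there x∈) = there (∈-map⁺ suc (∈-elements x∈))
∈-elements {p = Subset.outside ∷ p} (there x∈) = ∈-map⁺ suc (∈-elements x∈)

-- The successor and the predecessor along the cycle, wrapping around at both ends; they differ
-- because the length is at least 3. This keeps leaves of a tree off every cycle.
cycle-neighbours : ∀ {V} {G : Graph V} (C : Cycle G) (let open Cycle C) → ∀ i →
  ∃[ j ] ∃[ k ] j ≢ k × Adj G (vertex i) (vertex j) × Adj G (vertex i) (vertex k)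
cycle-neighbours {G = G} C zero = suc zero , fromℕ _ , (λ ()) , step zero , adj-sym G close
  where open Cycle C
cycle-neighbours {G = G} C (suc i) with view i
... | ‵fromℕ = zero , inject₁ (fromℕ _) , (λ ()) , close , adj-sym G (step (fromℕ _))
  where open Cycle C
... | ‵inj₁ {i = j} _ = suc (suc j) , inject₁ (inject₁ j) , distinct-ends j , step (suc j) , adj-sym G (step (inject₁ j))
  where
  open Cycle C
  distinct-ends : ∀ {m} (j : Fin m) → suc (suc j) ≢ inject₁ (inject₁ j)
  distinct-ends (suc j) eq = distinct-ends j (Finₚ.suc-injective eq)

-- The explicit constants.

layerBound : ℕ → ℕ → ℕ → ℕ
-- These bounds are strict: layer 0 is the root alone, so its independent sets have fewer than 2
-- vertices.
layerBound r s zero    = 2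
-- From the outside in: parents of earlier vertices against later vertices, parents of later
-- vertices against earlier ones, and parents against parents.
layerBound r s (suc k) = ramseyNumber r (ramseyNumber r (ramseyNumber s (layerBound r s k)))

independenceBound : ℕ → ℕ → ℕ → ℕ
independenceBound r s zero    = 1
independenceBound r s (suc k) = layerBound r s k + independenceBound r s k

-- Three dominating sets of at most `α` vertices, each vertex joined to the root by at most `m`
-- further vertices, give a core of at most `N ∸ 1` vertices; number `0` is added, and colours are
-- pairs.
colourBound : ℕ → ℕ → ℕ
colourBound α m = N * N
  where N = 2 + (α + (α + (α + 0))) * m

-- Induced stars and pendant cliques.

module _ {n : ℕ} (G : Graph (Fin n)) where

  private
    V = Fin n
    _~_ = Adj G

  Independent : Rel V 0ℓ
  Independent u v = u ≢ v × ¬ (u ~ v)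

  Independent-sym : Symmetric Independent
  Independent-sym (u≢v , u≁v) = u≢v ∘ sym , u≁v ∘ adj-sym G

  starCopy : ∀ c vs → All (c ~_) vs → AllPairs Independent vs → InducedCopy (star (length vs)) G
  starCopy c vs c~vs ind = f , inj , λ x y → mk⇔ (to x y) (from x y)
    where
    c~ : ∀ i → c ~ lookup vs i
    c~ i = All.lookup c~vs (∈-lookup i)

    lookup-ind : ∀ i j → i ≢ j → Independent (lookup vs i) (lookup vs j)
    lookup-ind = AllPairs-lookup Independent-sym ind

    f : _ → V
    f (inj₁ _) = c
    f (inj₂ i) = lookup vs i

    inj : ∀ {x y} → f x ≡ f y → x ≡ y
    inj {inj₁ _} {inj₁ _} eq = refl
    inj {inj₁ _} {inj₂ j} eq = ⊥-elim (adj-irrefl G eq (c~ j))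
    inj {inj₂ i} {inj₁ _} eq = ⊥-elim (adj-irrefl G (sym eq) (c~ i))
    inj {inj₂ i} {inj₂ j} eq with i Fin.≟ j
    ... | yes i≡j = cong inj₂ i≡j
    ... | no  i≢j = contradiction eq (proj₁ (lookup-ind i j i≢j))

    to : ∀ x y → StarAdj _ x y → f x ~ f y
    to (inj₁ _) (inj₂ j) _ = c~ j
    to (inj₂ i) (inj₁ _) _ = adj-sym G (c~ i)

    from : ∀ x y → f x ~ f y → StarAdj _ x y
    from (inj₁ _) (inj₁ _) e = adj-irrefl G refl e
    from (inj₁ _) (inj₂ _) e = tt
    from (inj₂ _) (inj₁ _) e = tt
    from (inj₂ i) (inj₂ j) e with i Fin.≟ j
    ... | yes refl = adj-irrefl G refl e
    ... | no  i≢j  = proj₂ (lookup-ind i j i≢j) e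

  module _ (p : V → V) where

    PendantPair : Rel V 0ℓ
    PendantPair u v = Independent u v × ¬ (p u ~ v) × ¬ (p v ~ u) × p u ~ p v

    PendantPair-sym : Symmetric PendantPair
    PendantPair-sym (ind , a , b , c) = Independent-sym ind , b , a , adj-sym G c

    -- Since `p (q i)` is adjacent to `q j` only when `i ≡ j`, either of `p (q i)` and `q i`
    -- determines `i`. If `p (q i)` were equal to `q j`, its adjacency to `q i` would be a loop or
    -- an edge between independent vertices.
    pendantCliqueCopy : ∀ vs → All (λ v → p v ~ v) vs → AllPairs PendantPair vs →
                        InducedCopy (pendantClique (length vs)) G
    pendantCliqueCopy vs p~vs pairs = f , inj , λ x y → mk⇔ (to x y) (from x y)
      where
      q : Fin (length vs) → V
      q = lookup vs

      p~ : ∀ i → p (q i) ~ q i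
      p~ i = All.lookup p~vs (∈-lookup i)

      pair : ∀ i j → i ≢ j → PendantPair (q i) (q j)
      pair = AllPairs-lookup PendantPair-sym pairs

      f : _ → V
      f (inj₁ i) = p (q i)
      f (inj₂ i) = q i

      p≢q : ∀ i j → p (q i) ≢ q j
      p≢q i j eq with i Fin.≟ j
      ... | yes refl = adj-irrefl G eq (p~ i)
      ... | no  i≢j  = proj₂ (proj₁ (pair j i (i≢j ∘ sym))) (subst (_~ q i) eq (p~ i))

      p~q⇒≡ : ∀ i j → p (q i) ~ q j → i ≡ j
      p~q⇒≡ i j e with i Fin.≟ j
      ... | yes i≡j = i≡j
      ... | no  i≢j = contradiction e (proj₁ (proj₂ (pair i j i≢j)))

      inj : ∀ {x y} → f x ≡ f y → x ≡ y
      inj {inj₁ i} {inj₁ j} eq = cong inj₁ (p~q⇒≡ i j (subst (_~ q j) (sym eq) (p~ j)))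
      inj {inj₁ i} {inj₂ j} eq = contradiction eq (p≢q i j)
      inj {inj₂ i} {inj₁ j} eq = contradiction (sym eq) (p≢q j i)
      inj {inj₂ i} {inj₂ j} eq = cong inj₂ (p~q⇒≡ i j (subst (p (q i) ~_) eq (p~ i)))

      to : ∀ x y → PendantAdj _ x y → f x ~ f y
      to (inj₁ i) (inj₁ j) i≢j  = proj₂ (proj₂ (proj₂ (pair i j i≢j)))
      to (inj₁ i) (inj₂ j) refl = p~ i
      to (inj₂ i) (inj₁ j) refl = adj-sym G (p~ i)

      from : ∀ x y → f x ~ f y → PendantAdj _ x y
      from (inj₁ i) (inj₁ j) e refl = adj-irrefl G refl e
      from (inj₁ i) (inj₂ j) e = p~q⇒≡ i j e
      from (inj₂ i) (inj₁ j) e = sym (p~q⇒≡ j i (adj-sym G e))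
      from (inj₂ i) (inj₂ j) e with i Fin.≟ j
      ... | yes refl = adj-irrefl G refl e
      ... | no  i≢j  = proj₂ (proj₁ (pair i j i≢j)) e

  -- Layers by distance from a root.

  record Layering : Set where
    field
      root         : V
      depth        : V → ℕ
      parent       : V → V
      depth≡0      : ∀ {v} → depth v ≡ 0 → v ≡ root
      depth-parent : ∀ {k v} → depth v ≡ suc k → depth (parent v) ≡ k
      parent-adj   : ∀ {k v} → depth v ≡ suc k → parent v ~ v
      depth-adj    : ∀ {u v} → u ~ v → depth v ≤ suc (depth u)

  module _ (conn : Connected G) (x : V) where

    -- Walks with exactly `k` edges: decidable by recursion on `k`, and the least such `k` is the
    -- distance from `x`.
    Reach : ℕ → V → Set
    Reach zero    v = x ≡ v
    Reach (suc k) v = ∃[ u ] Reach k u × u ~ v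

    reach? : ∀ k → U.Decidable (Reach k)
    reach? zero    v = x Fin.≟ v
    reach? (suc k) v = Finₚ.any? λ u → reach? k u ×-dec adj? G u v

    reach-walk : ∀ {k u v} → Reach k u → Star _~_ u v → ∃[ m ] Reach m v
    reach-walk r ε        = _ , r
    reach-walk r (e ◅ es) = reach-walk (_ , r , e) es

    distanceLayering : Layering
    distanceLayering = record
      { root         = x
      ; depth        = d
      ; parent       = λ v → proj₁ (step v)
      ; depth≡0      = λ {v} eq → sym (subst (λ k → Reach k v) eq (reach-d v))
      ; depth-parent = λ {k} {v} eq → proj₁ (proj₂ (step v) k eq)
      ; parent-adj   = λ {k} {v} eq → proj₂ (proj₂ (step v) k eq)
      ; depth-adj    = λ {u} {v} e → d-min v (suc (d u)) (u , reach-d u , e)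
      }
      where
      minimal : ∀ v → ∃ (IsMinimum (λ k → Reach k v))
      minimal v = let m , r = reach-walk {0} refl (conn x v) in least (λ k → reach? k v) m r

      d : V → ℕ
      d v = proj₁ (minimal v)

      reach-d : ∀ v → Reach (d v) v
      reach-d v = proj₁ (proj₂ (minimal v))

      d-min : ∀ v k → Reach k v → d v ≤ k
      d-min v = proj₂ (proj₂ (minimal v))

      step : ∀ v → ∃[ u ] (∀ k → d v ≡ suc k → d u ≡ k × u ~ v)
      step v with d v in eq | reach-d v
      -- The root serves as its own default parent; the required property is vacuous at depth 0.
      ... | zero  | _           = v , λ _ ()
      -- The parent is the last vertex before `v` on a shortest walk. A shorter walk to `u` would
      -- shorten the one to `v`, so `u` has depth exactly `k`.
      ... | suc k | (u , r , e) = u , λ { _ refl →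
        ℕₚ.≤-antisym (d-min u k r)
          (ℕ.s≤s⁻¹ (subst (_≤ suc (d u)) eq (d-min v _ (u , reach-d u , e)))) , e }

  -- Induced paths along ancestors.

  module _ (L : Layering) where
    open Layering L

    ancestor : V → ℕ → V
    ancestor v zero    = v
    ancestor v (suc i) = parent (ancestor v i)

    depth-ancestor : ∀ v k i → depth v ≡ k + i → depth (ancestor v i) ≡ k
    depth-ancestor v k zero    eq = trans eq (ℕₚ.+-identityʳ k)
    depth-ancestor v k (suc i) eq =
      depth-parent (depth-ancestor v (suc k) i (trans eq (ℕₚ.+-suc k i)))

    -- Depth falls by exactly one at each ancestor and changes by at most one along an edge, so no
    -- two non-consecutive ancestors are adjacent.
    pathCopy : ∀ ℓ v → ℓ ≤ depth v → InducedCopy (path ℓ) G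
    pathCopy ℓ v ℓ≤d = f , inj , λ i j → mk⇔ (to i j) (from i j)
      where
      f : Fin ℓ → V
      f i = ancestor v (toℕ i)

      i<d : ∀ (i : Fin ℓ) → toℕ i < depth v
      i<d i = ℕₚ.<-≤-trans (Finₚ.toℕ<n i) ℓ≤d

      depth+i : ∀ i → depth (f i) + toℕ i ≡ depth v
      depth+i i = trans (cong (_+ toℕ i) (depth-ancestor v _ (toℕ i) (sym eq))) eq
        where eq = ℕₚ.m∸n+n≡m (ℕₚ.<⇒≤ (i<d i))

      up : ∀ i → parent (f i) ~ f i
      up i = parent-adj (depth-ancestor v (suc (depth v ∸ suc (toℕ i))) (toℕ i)
        (sym (trans (sym (ℕₚ.+-suc _ (toℕ i))) (ℕₚ.m∸n+n≡m (i<d i)))))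

      inj : ∀ {i j} → f i ≡ f j → i ≡ j
      inj {i} {j} eq = Finₚ.toℕ-injective (ℕₚ.+-cancelˡ-≡ (depth (f i)) _ _
        (trans (depth+i i) (sym (trans (cong (λ w → depth w + toℕ j) eq) (depth+i j)))))

      to : ∀ i j → Adj (path ℓ) i j → f i ~ f j
      to i j (inj₁ eq) = adj-sym G (subst (λ k → ancestor v k ~ f i) eq (up i))
      to i j (inj₂ eq) = subst (λ k → ancestor v k ~ f j) eq (up j)

      next : ∀ i j → f i ~ f j → toℕ i < toℕ j → suc (toℕ i) ≡ toℕ j
      next i j e i<j = ℕₚ.≤-antisym i<j (ℕₚ.+-cancelˡ-≤ (depth (f j)) _ _ (begin
        depth (f j) + toℕ j       ≡⟨ depth+i j ⟩
        depth v                   ≡⟨ depth+i i ⟨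
        depth (f i) + toℕ i       ≤⟨ ℕₚ.+-monoˡ-≤ (toℕ i) (depth-adj (adj-sym G e)) ⟩
        suc (depth (f j)) + toℕ i ≡⟨ ℕₚ.+-suc (depth (f j)) (toℕ i) ⟨
        depth (f j) + suc (toℕ i) ∎))
        where open ℕₚ.≤-Reasoning

      from : ∀ i j → f i ~ f j → Adj (path ℓ) i j
      from i j e with ℕₚ.<-cmp (toℕ i) (toℕ j)
      ... | tri< i<j _ _ = inj₁ (next i j e i<j)
      ... | tri≈ _ i≡j _ = ⊥-elim (adj-irrefl G (cong (ancestor v) i≡j) e)
      ... | tri> _ _ j<i = inj₂ (next j i (adj-sym G e) j<i)

    -- Bounding independent sets.

    module _ {r s : ℕ} (0<r : 0 < r) (noStar : star r -Free G) (noPendant : pendantClique s -Free G) where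

      private
        Below : V → Set
        Below v = parent v ~ v

      no-common-neighbour : ∀ {c vs} → length vs ≡ r → All (c ~_) vs → ¬ AllPairs Independent vs
      no-common-neighbour refl c~vs ind = noStar (starCopy _ _ c~vs ind)

      -- The parent of the first vertex is adjacent to every vertex of the list, hence the centre of
      -- an induced star.
      no-forward-clique : ∀ {vs} → length vs ≡ r → All Below vs → AllPairs Independent vs →
                          ¬ AllPairs (λ u v → parent u ~ v) vs
      no-forward-clique {[]}    refl _           _   _       = contradiction 0<r λ ()
      no-forward-clique {_ ∷ _} l    (below ∷ _) ind (c ∷ _) = no-common-neighbour l (below ∷ c) ind

      -- Here the parent of the last vertex is the centre of the star.
      no-backward-clique : ∀ {vs} → length vs ≡ r → All Below vs → AllPairs Independent vs →
                           ¬ AllPairs (λ u v → parent v ~ u) vs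
      no-backward-clique {[]}     refl _     _   _     = contradiction 0<r λ ()
      no-backward-clique {v ∷ vs} l    below ind clique =
        no-common-neighbour l (proj₂ (proj₂ (last v vs below clique))) ind
        where
        last : ∀ v vs → All Below (v ∷ vs) → AllPairs (λ u w → parent w ~ u) (v ∷ vs) →
               ∃[ w ] w ∈ v ∷ vs × All (parent w ~_) (v ∷ vs)
        last v []       (b ∷ _)  _        = v , here refl , b ∷ []
        last v (u ∷ us) (_ ∷ bs) (c ∷ cs) =
          let w , w∈ , ws = last u us bs cs in w , there w∈ , All.lookup c w∈ ∷ ws

      no-pendant-clique : ∀ {vs} → length vs ≡ s → All Below vs → ¬ AllPairs (PendantPair parent) vs
      no-pendant-clique refl below pairs = noPendant (pendantCliqueCopy parent _ below pairs)

      layer-independent : ∀ k vs → All (λ v → depth v ≡ k) vs → AllPairs Independent vs →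
                          length vs < layerBound r s k
      layer-independent zero []           _             _                     = s≤s z≤n
      layer-independent zero (v ∷ [])     _             _                     = s≤s (s≤s z≤n)
      layer-independent zero (u ∷ v ∷ vs) (du ∷ dv ∷ _) (((u≢v , _) ∷ _) ∷ _) =
        contradiction (trans (depth≡0 du) (sym (depth≡0 dv))) u≢v
      layer-independent (suc k) vs dvs ind = ℕₚ.≰⇒> impossible
        where
        below : All Below vs
        below = All.map parent-adj dvs

        impossible : ¬ layerBound r s (suc k) ≤ length vs
        impossible h with ramsey (λ u v → adj? G (parent u) v) r _ vs h
        ... | inj₁ (us , τ , l , c) =
          no-forward-clique l (All-resp-⊆ τ below) (AllPairs-resp-⊆ τ ind) c
        ... | inj₂ (us , τ , l , p≁) with ramsey (λ u v → adj? G (parent v) u) r _ us (ℕₚ.≤-reflexive (sym l))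
        ...   | inj₁ (ws , σ , l′ , c) =
          no-backward-clique l′ (All-resp-⊆ (⊆-trans σ τ) below) (AllPairs-resp-⊆ (⊆-trans σ τ) ind) c
        -- With `p≁` and `≁p` together, each parent is adjacent to no vertex of `ws` but its own
        -- child.
        ...   | inj₂ (ws , σ , l′ , ≁p)
          with ramsey (λ u v → adj? G (parent u) (parent v)) s _ ws (ℕₚ.≤-reflexive (sym l′))
        ...     | inj₁ (zs , ρ , l″ , c) =
          no-pendant-clique l″ (All-resp-⊆ (⊆-trans ρ (⊆-trans σ τ)) below)
            (AllPairs.zip (AllPairs-resp-⊆ (⊆-trans ρ (⊆-trans σ τ)) ind ,
             AllPairs.zip (AllPairs-resp-⊆ (⊆-trans ρ σ) p≁ ,
             AllPairs.zip (AllPairs-resp-⊆ ρ ≁p , c))))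
        -- The parents are an independent set of layer `k` whose size equals the strict bound of the
        -- induction hypothesis.
        ...     | inj₂ (zs , ρ , l″ , p≁p) =
          ℕₚ.<-irrefl (trans (Listₚ.length-map parent zs) l″)
            (layer-independent k (map parent zs)
              (Allₚ.map⁺ (All.map depth-parent (All-resp-⊆ (⊆-trans ρ (⊆-trans σ τ)) dvs)))
              (AllPairsₚ.map⁺ (AllPairs.zip (distinct , p≁p))))
          where
          -- A parent shared by `u` and `v` would be adjacent to `v`, which `parent u` is not.
          separate : ∀ {us} → All Below us → AllPairs (λ u v → ¬ (parent u ~ v)) us →
                     AllPairs (λ u v → parent u ≢ parent v) us
          separate []       []       = []
          separate (_ ∷ bs) (c ∷ cs) =
            All.zipWith (λ (b , u≁v) eq → u≁v (subst (_~ _) (sym eq) b)) (bs , c) ∷ separate bs cs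

          distinct = separate (All-resp-⊆ (⊆-trans ρ (⊆-trans σ τ)) below)
                              (AllPairs-resp-⊆ (⊆-trans ρ σ) p≁)

      independent-bounded : ∀ k vs → All (λ v → depth v < k) vs → AllPairs Independent vs →
                            length vs < independenceBound r s k
      independent-bounded zero    []       _   _   = s≤s z≤n
      independent-bounded zero    (_ ∷ _)  (() ∷ _) _
      independent-bounded (suc k) vs       dvs ind = ℕₚ.≰⇒> impossible
        where
        impossible : ¬ independenceBound r s (suc k) ≤ length vs
        impossible h with pigeonhole (λ v → depth v ℕ.≟ k) (layerBound r s k) _ vs h
        ... | inj₁ (us , τ , l , eqs) =
          ℕₚ.<-irrefl l (layer-independent k us eqs (AllPairs-resp-⊆ τ ind))
        ... | inj₂ (us , τ , l , neqs) =
          ℕₚ.<-irrefl l (independent-bounded k us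
            (All.zipWith (λ (d<1+k , d≢k) → ℕₚ.≤∧≢⇒< (ℕ.s≤s⁻¹ d<1+k) d≢k) (All-resp-⊆ τ dvs , neqs))
            (AllPairs-resp-⊆ τ ind))

  -- Maximal independent sets as dominating sets.

  -- A greedy pass rejects a vertex with `P` only if it is already chosen or has a chosen neighbour,
  -- so maximality appears directly as domination.
  maximalIndependent : {P : V → Set} → U.Decidable P →
    ∃[ vs ] All P vs × AllPairs Independent vs × (∀ v → P v → v ∈ vs ⊎ ∃[ a ] a ∈ vs × v ~ a)
  maximalIndependent {P} P? = let vs , ps , ind , max = greedy (allFin n) in
    vs , ps , ind , λ v → max (∈-allFin v)
    where
    greedy : ∀ us → ∃[ vs ] All P vs × AllPairs Independent vs ×
                      (∀ {v} → v ∈ us → P v → v ∈ vs ⊎ ∃[ a ] a ∈ vs × v ~ a)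
    greedy [] = [] , [] , [] , λ ()
    greedy (u ∷ us) with greedy us
    ... | vs , ps , ind , max with P? u
    ... | no ¬pu = vs , ps , ind , λ { (here refl) p → contradiction p ¬pu ; (there v∈) → max v∈ }
    ... | yes pu with Any.any? (u Fin.≟_) vs | Any.any? (adj? G u) vs
    ... | yes u∈ | _ = vs , ps , ind , λ { (here refl) _ → inj₁ u∈ ; (there v∈) → max v∈ }
    ... | no _ | yes u~ = vs , ps , ind , λ { (here refl) _ → inj₂ (find u~) ; (there v∈) → max v∈ }
    ... | no u∉ | no u≁ =
      u ∷ vs , pu ∷ ps , All.zip (Allₚ.¬Any⇒All¬ vs u∉ , Allₚ.¬Any⇒All¬ vs u≁) ∷ ind ,
      λ { (here refl) _ → inj₁ (here refl)
        ; (there v∈) p → Sum.map there (λ (a , a∈ , e) → a , there a∈ , e) (max v∈ p) }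

  DominatesOutside : List V → List V → Set
  DominatesOutside B I = All (_∉ B) I × (∀ v → v ∉ B → v ∈ I ⊎ ∃[ a ] a ∈ I × v ~ a)

  dominateOutside : ∀ {α} → (∀ {vs} → AllPairs Independent vs → length vs ≤ α) →
                    ∀ {B m} → length B ≤ m → ∃[ I ] DominatesOutside B I × length (I ++ B) ≤ α + m
  dominateOutside ind≤α {B} |B|≤m = let I , fresh , ind , max = maximalIndependent (λ v → ¬? (v ∈? B)) in
    I , (fresh , max) ,
    ℕₚ.≤-trans (ℕₚ.≤-reflexive (Listₚ.length-++ I)) (ℕₚ.+-mono-≤ (ind≤α ind) |B|≤m)

  -- Trees grown leaf by leaf.

  data GrownTree : List V → Set where
    single : ∀ v → GrownTree (v ∷ [])
    attach : ∀ {vs u a} → GrownTree vs → u ∉ vs → a ∈ vs → u ~ a → GrownTree (u ∷ vs)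

  Edge : ∀ {vs} → GrownTree vs → Rel V 0ℓ
  Edge (single _)                     x y = ⊥
  Edge (attach {u = u} {a} t _ _ _) x y = Edge t x y ⊎ (x ≡ u × y ≡ a) ⊎ (x ≡ a × y ≡ u)

  edge-sym : ∀ {vs} (t : GrownTree vs) → Symmetric (Edge t)
  edge-sym (attach t _ _ _) (inj₁ e)               = inj₁ (edge-sym t e)
  edge-sym (attach t _ _ _) (inj₂ (inj₁ (p , q))) = inj₂ (inj₂ (q , p))
  edge-sym (attach t _ _ _) (inj₂ (inj₂ (p , q))) = inj₂ (inj₁ (q , p))

  edge? : ∀ {vs} (t : GrownTree vs) → Decidable (Edge t)
  edge? (single _)                     x y = no λ ()
  edge? (attach {u = u} {a} t _ _ _) x y =
    edge? t x y ⊎-dec ((x Fin.≟ u ×-dec y Fin.≟ a) ⊎-dec (x Fin.≟ a ×-dec y Fin.≟ u))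

  edge⇒~ : ∀ {vs} (t : GrownTree vs) {x y} → Edge t x y → x ~ y
  edge⇒~ (attach t _ _ _)   (inj₁ e)                    = edge⇒~ t e
  edge⇒~ (attach t _ _ u~a) (inj₂ (inj₁ (refl , refl))) = u~a
  edge⇒~ (attach t _ _ u~a) (inj₂ (inj₂ (refl , refl))) = adj-sym G u~a

  edge⇒∈ˡ : ∀ {vs} (t : GrownTree vs) {x y} → Edge t x y → x ∈ vs
  edge⇒∈ˡ (attach t _ _ _)  (inj₁ e)                 = there (edge⇒∈ˡ t e)
  edge⇒∈ˡ (attach t _ _ _)  (inj₂ (inj₁ (refl , _))) = here refl
  edge⇒∈ˡ (attach t _ a∈ _) (inj₂ (inj₂ (refl , _))) = there a∈

  treeGraph : ∀ {vs} → GrownTree vs → Graph V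
  treeGraph t = record
    { Adj        = Edge t
    ; adj-sym    = edge-sym t
    ; adj-irrefl = λ eq e → adj-irrefl G eq (edge⇒~ t e)
    ; adj?       = edge? t
    }

  tree-connected : ∀ {vs} (t : GrownTree vs) {x y} → x ∈ vs → y ∈ vs → Star (Edge t) x y
  tree-connected (single _) (here refl) (here refl) = ε
  tree-connected (attach t _ a∈ _) (here refl) (here refl) = ε
  tree-connected (attach t _ a∈ _) (here refl) (there y∈) =
    inj₂ (inj₁ (refl , refl)) ◅ Star.map inj₁ (tree-connected t a∈ y∈)
  tree-connected (attach t _ a∈ _) (there x∈) (here refl) =
    Star.map inj₁ (tree-connected t x∈ a∈) ◅◅ (inj₂ (inj₂ (refl , refl)) ◅ ε)
  tree-connected (attach t _ a∈ _) (there x∈) (there y∈) = Star.map inj₁ (tree-connected t x∈ y∈)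

  -- The newest vertex has one neighbour, while a vertex on a cycle has two; so the cycle lies in
  -- the smaller tree.
  tree-acyclic : ∀ {vs} (t : GrownTree vs) → ¬ Cycle (treeGraph t)
  tree-acyclic (single _) C = Cycle.step C zero
  tree-acyclic T@(attach {vs} {u} {a} t u∉ a∈ u~a) C with Finₚ.any? (λ i → Cycle.vertex C i Fin.≟ u)
  ... | yes (i , vᵢ≡u) with cycle-neighbours C i
  ...   | j , k , j≢k , ej , ek = j≢k (Cycle.distinct C (trans (leaf ej) (sym (leaf ek))))
    where
    leaf : ∀ {y} → Edge T (Cycle.vertex C i) y → y ≡ a
    leaf (inj₁ e)                = contradiction (subst (_∈ vs) vᵢ≡u (edge⇒∈ˡ t e)) u∉
    leaf (inj₂ (inj₁ (_ , y≡a))) = y≡a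
    leaf (inj₂ (inj₂ (p , _)))   = contradiction (subst (_∈ vs) (trans (sym p) vᵢ≡u) a∈) u∉
  tree-acyclic T@(attach {vs} {u} {a} t u∉ a∈ u~a) C | no u-free = tree-acyclic t record
    { k        = Cycle.k C
    ; vertex   = Cycle.vertex C
    ; distinct = Cycle.distinct C
    ; step     = λ i → old _ _ (Cycle.step C i)
    ; close    = old _ _ (Cycle.close C)
    }
    where
    old : ∀ i j → Edge T (Cycle.vertex C i) (Cycle.vertex C j) → Edge t (Cycle.vertex C i) (Cycle.vertex C j)
    old i j (inj₁ e)              = e
    old i j (inj₂ (inj₁ (p , _))) = contradiction (i , p) u-free
    old i j (inj₂ (inj₂ (_ , p))) = contradiction (j , p) u-free

  treeSubgraph : ∀ {vs} → GrownTree vs → Subgraph G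
  treeSubgraph {vs} t = record
    { vertices = fromList vs
    ; edges    = treeGraph t
    ; edge⇒adj = edge⇒~ t
    ; edge⇒∈   = λ e → ∈-fromList⁺ (edge⇒∈ˡ t e) , ∈-fromList⁺ (edge⇒∈ˡ t (edge-sym t e))
    }

  tree-isTree : ∀ {vs} (t : GrownTree vs) → IsTree (treeSubgraph t)
  tree-isTree {vs} t = record
    { nonempty  = nonempty t
    ; connected = λ x∈ y∈ → tree-connected t (∈-fromList⁻ vs x∈) (∈-fromList⁻ vs y∈)
    ; acyclic   = tree-acyclic t
    }
    where
    nonempty : ∀ {vs} → GrownTree vs → Subset.Nonempty (fromList vs)
    nonempty (single v)                = v , ∈-fromList⁺ {vs = v ∷ []} (here refl)
    nonempty (attach {vs} {u} _ _ _ _) = u , ∈-fromList⁺ {vs = u ∷ vs} (here refl)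

  -- Small trees through given vertices.

  module _ (L : Layering) where
    open Layering L

    -- Induction along the chain of parents from the root: once the parent is in the tree, `v` costs
    -- at most one new vertex.
    growTo : ∀ {vs} → GrownTree vs → root ∈ vs → ∀ k {v} → depth v ≡ k →
             ∃[ ws ] GrownTree ws × vs ⊆ᵐ ws × v ∈ ws × length ws ≤ length vs + k
    growTo {vs} t root∈ zero d≡0 =
      vs , t , id , subst (_∈ vs) (sym (depth≡0 d≡0)) root∈ , ℕₚ.m≤m+n _ 0
    growTo {vs} t root∈ (suc k) {v} d≡ with growTo t root∈ k (depth-parent d≡)
    ... | ws , t′ , vs⊆ws , p∈ , bound with v ∈? ws
    ...   | yes v∈ = ws , t′ , vs⊆ws , v∈ , ℕₚ.≤-trans bound (ℕₚ.+-monoʳ-≤ (length vs) (ℕₚ.n≤1+n k))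
    ...   | no  v∉ = v ∷ ws , attach t′ v∉ p∈ (adj-sym G (parent-adj d≡)) , there ∘ vs⊆ws , here refl ,
      ℕₚ.≤-trans (s≤s bound) (ℕₚ.≤-reflexive (sym (ℕₚ.+-suc (length vs) k)))

    spanningTree : ∀ m → (∀ v → depth v ≤ m) → ∀ us →
      ∃[ vs ] GrownTree vs × root ∈ vs × us ⊆ᵐ vs × length vs ≤ suc (length us * m)
    spanningTree m d≤m [] = root ∷ [] , single root , here refl , (λ ()) , s≤s z≤n
    spanningTree m d≤m (u ∷ us) with spanningTree m d≤m us
    ... | vs , t , root∈ , us⊆vs , bound with growTo t root∈ (depth u) refl
    ...   | ws , t′ , vs⊆ws , u∈ , bound′ =
      ws , t′ , vs⊆ws root∈ , (λ { (here refl) → u∈ ; (there x∈) → vs⊆ws (us⊆vs x∈) }) , (begin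
        length ws                   ≤⟨ bound′ ⟩
        length vs + depth u         ≤⟨ ℕₚ.+-mono-≤ bound (d≤m u) ⟩
        suc (length us * m) + m     ≡⟨ ℕₚ.+-comm (suc (length us * m)) m ⟩
        m + suc (length us * m)     ≡⟨ ℕₚ.+-suc m (length us * m) ⟩
        suc (length (u ∷ us) * m)   ∎)
      where open ℕₚ.≤-Reasoning

  -- The colouring and its rainbow trees.

  module Colouring (D : List V) where

    idx : V → ℕ
    idx = rank D

    -- B collects the vertices of D at which an edge leaving D may already be attached.
    record Rainbow {vs} (t : GrownTree vs) (B : List V) : Set where
      field
        edge-unique : ∀ {x y x′ y′} → Edge t x y → Edge t x′ y′ →
                      idx x ≡ idx x′ → idx y ≡ idx y′ → x ≡ x′ × y ≡ y′
        outer-edge  : ∀ {x y} → Edge t x y → idx x ≡ 0 → y ∈ B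

    core-rainbow : (t : GrownTree D) → Rainbow t []
    core-rainbow t = record
      { edge-unique = λ e e′ p q → rank-injective D (edge⇒∈ˡ t e) (edge⇒∈ˡ t e′) p ,
          rank-injective D (edge⇒∈ˡ t (edge-sym t e)) (edge⇒∈ˡ t (edge-sym t e′)) q
      ; outer-edge = λ e p → contradiction p (rank-∈ (edge⇒∈ˡ t e))
      }

    -- A vertex `u` not yet in the tree lies outside `D`, so it has a neighbour `a` in `I`. The new
    -- edge has numbers `0` and `idx a`; earlier edges leaving `D` end in `B`, which `I` avoids, so
    -- this pair is new.
    attach-rainbow : ∀ {vs B I} (t : GrownTree vs) → D ⊆ᵐ vs → Rainbow t B →
      DominatesOutside B I → I ++ B ⊆ᵐ D → ∀ u →
      ∃[ ws ] Σ[ t′ ∈ GrownTree ws ] vs ⊆ᵐ ws × u ∈ ws × Rainbow t′ (I ++ B)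
    attach-rainbow {vs} {B} {I} t D⊆vs rb (fresh , dominates) I++B⊆D u with u ∈? vs
    ... | yes u∈ = vs , t , id , u∈ , record
      { edge-unique = Rainbow.edge-unique rb
      ; outer-edge  = λ e p → ∈-++⁺ʳ I (Rainbow.outer-edge rb e p) }
    ... | no u∉ with dominates u (λ u∈B → u∉ (D⊆vs (I++B⊆D (∈-++⁺ʳ I u∈B))))
    ...   | inj₁ u∈I = contradiction (D⊆vs (I++B⊆D (∈-++⁺ˡ u∈I))) u∉
    ...   | inj₂ (a , a∈I , u~a) = u ∷ vs , t′ , there , here refl , record
      { edge-unique = unique ; outer-edge = outer }
      where
      a∈D : a ∈ D
      a∈D = I++B⊆D (∈-++⁺ˡ a∈I)

      t′ : GrownTree (u ∷ vs)
      t′ = attach t u∉ (D⊆vs a∈D) u~a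

      idx-u : idx u ≡ 0
      idx-u = rank-∉ D (u∉ ∘ D⊆vs)

      idx-a : idx a ≢ 0
      idx-a = rank-∈ a∈D

      -- An old edge with these numbers would end at a vertex of `B` numbered like `a`, hence at `a`
      -- itself.
      new : ∀ {x y} → Edge t x y → idx x ≡ idx u → idx y ≡ idx a → ⊥
      new e p q = All.lookup fresh a∈I (subst (_∈ B) (rank-injective D (I++B⊆D (∈-++⁺ʳ I y∈B)) a∈D q) y∈B)
        where y∈B = Rainbow.outer-edge rb e (trans p idx-u)

      u≠a : idx u ≢ idx a
      u≠a eq = idx-a (trans (sym eq) idx-u)

      unique : ∀ {x y x′ y′} → Edge t′ x y → Edge t′ x′ y′ →
               idx x ≡ idx x′ → idx y ≡ idx y′ → x ≡ x′ × y ≡ y′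
      unique (inj₁ e) (inj₁ e′) p q = Rainbow.edge-unique rb e e′ p q
      unique (inj₁ e) (inj₂ (inj₁ (refl , refl))) p q = ⊥-elim (new e p q)
      unique (inj₁ e) (inj₂ (inj₂ (refl , refl))) p q = ⊥-elim (new (edge-sym t e) q p)
      unique (inj₂ (inj₁ (refl , refl))) (inj₁ e) p q = ⊥-elim (new e (sym p) (sym q))
      unique (inj₂ (inj₂ (refl , refl))) (inj₁ e) p q = ⊥-elim (new (edge-sym t e) (sym q) (sym p))
      unique (inj₂ (inj₁ (refl , refl))) (inj₂ (inj₁ (refl , refl))) p q = refl , refl
      unique (inj₂ (inj₁ (refl , refl))) (inj₂ (inj₂ (refl , refl))) p q = contradiction p u≠a
      unique (inj₂ (inj₂ (refl , refl))) (inj₂ (inj₁ (refl , refl))) p q = contradiction q u≠a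
      unique (inj₂ (inj₂ (refl , refl))) (inj₂ (inj₂ (refl , refl))) p q = refl , refl

      outer : ∀ {x y} → Edge t′ x y → idx x ≡ 0 → y ∈ I ++ B
      outer (inj₁ e)                    p = ∈-++⁺ʳ I (Rainbow.outer-edge rb e p)
      outer (inj₂ (inj₁ (refl , refl))) p = ∈-++⁺ˡ a∈I
      outer (inj₂ (inj₂ (refl , refl))) p = contradiction p idx-a

    module _ {N : ℕ} (|D|<N : length D < N) where

      label : V → Fin N
      label v = fromℕ< (ℕₚ.≤-<-trans (rank-≤ D v) |D|<N)

      label≡⇒idx≡ : ∀ {u v} → label u ≡ label v → idx u ≡ idx v
      label≡⇒idx≡ = Finₚ.fromℕ<-injective _ _ _ _

      colouring : EdgeColouring G (N * N)
      colouring = record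
        { colour     = λ {u} {v} _ → pairCode (label u) (label v)
        ; colour-sym = λ {u} {v} _ _ → pairCode-comm (label u) (label v)
        }

      Rainbow⇒IsRainbow : ∀ {vs B} (t : GrownTree vs) → Rainbow t B → IsRainbow colouring (treeSubgraph t)
      Rainbow⇒IsRainbow t rb {u} {v} {x} {y} e f eq
        -- A colour fixes the two numbers up to order; the crossed case is the straight one for the
        -- reversed edge.
        with pairCode-injective (label u) (label v) (label x) (label y) eq
      ... | inj₁ (p , q) = inj₁ (Rainbow.edge-unique rb e f (label≡⇒idx≡ p) (label≡⇒idx≡ q))
      ... | inj₂ (p , q) = inj₂ (Rainbow.edge-unique rb e (edge-sym t f) (label≡⇒idx≡ p) (label≡⇒idx≡ q))

      is3Rainbow : GrownTree D → ∀ {I₁ I₂ I₃} → DominatesOutside [] I₁ → DominatesOutside (I₁ ++ []) I₂ →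
        DominatesOutside (I₂ ++ I₁ ++ []) I₃ → I₃ ++ I₂ ++ I₁ ++ [] ⊆ᵐ D → Is3RainbowColouring colouring
      is3Rainbow t {I₁} {I₂} {I₃} dom₁ dom₂ dom₃ I⊆D S |S|≡3
        -- Taking the list together with its length leaves only the case of three entries.
        with elements S | trans (length-elements S) |S|≡3 | (λ {x} → ∈-elements {p = S} {x})
      ... | u ∷ v ∷ w ∷ [] | _ | S⊆
        with attach-rainbow t id (core-rainbow t) dom₁ (I⊆D ∘ ∈-++⁺ʳ I₃ ∘ ∈-++⁺ʳ I₂) u
      ... | _ , t₁ , ⊆₁ , u∈ , rb₁ with attach-rainbow t₁ ⊆₁ rb₁ dom₂ (I⊆D ∘ ∈-++⁺ʳ I₃) v
      ... | _ , t₂ , ⊆₂ , v∈ , rb₂ with attach-rainbow t₂ (⊆₂ ∘ ⊆₁) rb₂ dom₃ I⊆D w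
      ... | vs , t₃ , ⊆₃ , w∈ , rb₃ =
        treeSubgraph t₃ ,
        record { isTree = tree-isTree t₃ ; contains = λ x∈S → ∈-fromList⁺ (member (S⊆ x∈S)) } ,
        Rainbow⇒IsRainbow t₃ rb₃
        where
        member : ∀ {x} → x ∈ u ∷ v ∷ w ∷ [] → x ∈ vs
        member (here refl)                 = ⊆₃ (⊆₂ u∈)
        member (there (here refl))         = ⊆₃ v∈
        member (there (there (here refl))) = w∈

  rainbowColouring : ∀ {α m} → (∀ {vs} → AllPairs Independent vs → length vs ≤ α) →
    (L : Layering) → (∀ v → Layering.depth L v ≤ m) →
    Σ[ c ∈ EdgeColouring G (colourBound α m) ] Is3RainbowColouring c
  rainbowColouring {m = m} ind≤α L depth≤m =
    let I₁ , dom₁ , |I₁|≤       = dominateOutside ind≤α z≤n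
        I₂ , dom₂ , |I₂|≤       = dominateOutside ind≤α |I₁|≤
        I₃ , dom₃ , |I₃|≤       = dominateOutside ind≤α |I₂|≤
        D , t , _ , I⊆D , |D|≤  = spanningTree L m depth≤m (I₃ ++ I₂ ++ I₁ ++ [])
        -- The core has at most `1 + 3αm` vertices, one less than `N`.
        |D|<N                   = s≤s (ℕₚ.≤-trans |D|≤ (s≤s (ℕₚ.*-monoˡ-≤ m |I₃|≤)))
    in Colouring.colouring D |D|<N , Colouring.is3Rainbow D |D|<N t dom₁ dom₂ dom₃ I⊆D

-- The absolute bound on the rainbow index.

theorem9 : ∀ (r s ℓ : ℕ) → 3 ≤ r → 3 ≤ s → 4 < ℓ →
    Σ[ C ∈ ℕ ]
    (∀ (n : ℕ) (G : Graph (Fin n)) → 3 ≤ n → Connected G →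
    star r -Free G → pendantClique s -Free G → path ℓ -Free G →
    ∀ (rx₃ sdiam₃ : ℕ) → IsRx₃ G rx₃ → IsSdiam₃ G sdiam₃ →
    rx₃ ≤ sdiam₃ + C)
theorem9 r s ℓ 3≤r _ _ = colourBound (independenceBound r s ℓ) ℓ , bound
  where
  bound : ∀ n (G : Graph (Fin n)) → 3 ≤ n → Connected G →
          star r -Free G → pendantClique s -Free G → path ℓ -Free G →
          ∀ rx₃ sdiam₃ → IsRx₃ G rx₃ → IsSdiam₃ G sdiam₃ → rx₃ ≤ sdiam₃ + colourBound (independenceBound r s ℓ) ℓ
  bound (suc n) G _ conn noStar noPendant noPath rx₃ sdiam₃ (_ , rx₃-min) _ =
    ℕₚ.≤-trans (rx₃-min _ (rainbowColouring G small L (ℕₚ.<⇒≤ ∘ depth<ℓ))) (ℕₚ.m≤n+m _ sdiam₃)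
    where
    L : Layering G
    L = distanceLayering G conn zero

    depth<ℓ : ∀ v → Layering.depth L v < ℓ
    -- A vertex of depth at least `ℓ` would have `ℓ` successive ancestors, itself included, inducing
    -- a path.
    depth<ℓ v = ℕₚ.≰⇒> (λ ℓ≤d → noPath (pathCopy G L ℓ v ℓ≤d))

    small : ∀ {vs} → AllPairs (Independent G) vs → length vs ≤ independenceBound r s ℓ
    small {vs} ind = ℕₚ.<⇒≤ (independent-bounded G L (ℕₚ.≤-trans (s≤s z≤n) 3≤r) noStar noPendant ℓ vs
      (All.universal depth<ℓ vs) ind)
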